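{- Let $k, m, n$ be positive integers with $m \leqslant n$. Then: (i) $F_k = L_m L_n$ holds if and only if $$(k,m,n) \in \{(1,1,1),\ (2,1,1),\ (4,1,2),\ (8,2,4)\}.$$ (ii) $L_k = F_m F_n$ holds if and only if $$(k,m,n) \in \{(1,1,1),\ (1,1,2),\ (1,2,2),\ (2,1,4),\ (2,2,4),\ (3,3,3)\}.$$
   Context: $(F_n)_{n\geqslant 0}$ is the Fibonacci sequence: $F_0=0$, $F_1=1$, $F_{n+1}=F_n+F_{n-1}$ for $n \geqslant 1$. $(L_n)_{n\geqslant 0}$ is the Lucas sequence: $L_0=2$, $L_1=1$, $L_{n+1}=L_n+L_{n-1}$ for $n\geqslant 1$. -}

module Defs where

open import Data.Nat using (ℕ; zero; suc; _+_)

F : ℕ → ℕ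
F zero          = 0
F (suc zero)    = 1
F (suc (suc n)) = F (suc n) + F n

L : ℕ → ℕ
L zero          = 2
L (suc zero)    = 1
L (suc (suc n)) = L (suc n) + L n

{-# OPTIONS --safe #-}

-- For fixed shifts, L m * L n and F (m + n + c) satisfy the Fibonacci recurrence in each of
-- m and n, so a strict inequality between them propagates from four base cases.
-- In this way, L m * L n lies strictly between F (m + n + 1) and F (m + n + 2), and F m * F n
-- strictly between two consecutive Lucas numbers, outside a few small cases.

module Submission where

open import Defs
open import Data.Nat using (ℕ; zero; suc; _+_; _*_; _≤_; _<_; s≤s; _<?_)
open import Data.Nat.Properties
  using (+-mono-<; *-distribˡ-+; *-distribʳ-+; <-trans; <-irrefl; <-asym; <-cmp; m≤n⇒m<n∨m≡n)
open import Data.List using (List; _∷_; [])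
open import Data.List.Membership.Propositional using (_∈_)
open import Data.List.Relation.Unary.Any using (here; there)
open import Data.Product using (_×_; _,_; proj₁)
open import Data.Sum using (inj₁; inj₂)
open import Data.Empty using (⊥-elim)
open import Function.Bundles using (_⇔_; mk⇔)
open import Relation.Binary.Definitions using (tri<; tri≈; tri>)
open import Relation.Binary.PropositionalEquality using (_≡_; _≢_; refl; sym; subst₂)
open import Relation.Nullary.Decidable using (True; toWitness)

-- A record rather than a plain function type, so that unification can read `f` off a proof of
-- `Recurrent f`.
record Recurrent (f : ℕ → ℕ) : Set where
  constructor recurrent
  field step : ∀ n → f (2 + n) ≡ f (1 + n) + f n

open Recurrent

shift : ∀ c {f} → Recurrent f → Recurrent (λ n → f (c + n))
shift zero    rf = rf
shift (suc c) {f} rf = shift c {λ n → f (suc n)} (recurrent (λ n → step rf (suc n)))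

recurrent-< : ∀ {f g} → Recurrent f → Recurrent g → f 0 < g 0 → f 1 < g 1 → ∀ n → f n < g n
recurrent-< rf rg p₀ p₁ zero = p₀
recurrent-< rf rg p₀ p₁ (suc zero) = p₁
recurrent-< rf rg p₀ p₁ (suc (suc n)) =
  subst₂ _<_ (sym (step rf n)) (sym (step rg n))
    (+-mono-< (recurrent-< rf rg p₀ p₁ (suc n)) (recurrent-< rf rg p₀ p₁ n))

*-recurrentˡ : ∀ c {f} → Recurrent f → Recurrent (λ n → c * f n)
*-recurrentˡ c {f} rf .step n rewrite step rf n = *-distribˡ-+ c (f (1 + n)) (f n)

*-recurrentʳ : ∀ c {f} → Recurrent f → Recurrent (λ n → f n * c)
*-recurrentʳ c {f} rf .step n rewrite step rf n = *-distribʳ-+ c (f (1 + n)) (f n)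

Between : ℕ → ℕ → ℕ → Set
Between a v b = a < v × v < b

-- On closed numerals both `True` arguments reduce to the unit type and are filled in, so evaluation
-- settles the base cases.
between : ∀ {a v b} {_ : True (a <? v)} {_ : True (v <? b)} → Between a v b
between {_} {_} {_} {p} {q} = toWitness p , toWitness q

recurrent-between : ∀ {f g h} → Recurrent f → Recurrent g → Recurrent h →
  Between (f 0) (g 0) (h 0) → Between (f 1) (g 1) (h 1) → ∀ n → Between (f n) (g n) (h n)
recurrent-between rf rg rh (p₀ , q₀) (p₁ , q₁) n =
  recurrent-< rf rg p₀ p₁ n , recurrent-< rg rh q₀ q₁ n

-- The recurrence in `n` settles the rows `m = 0` and `m = 1`; for each fixed `n` these are the base
-- cases of the recurrence in `m`.
product-between : ∀ {f g h} → Recurrent f → Recurrent g → Recurrent h →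
  Between (h 0) (f 0 * g 0) (h 1) → Between (h 1) (f 0 * g 1) (h 2) →
  Between (h 1) (f 1 * g 0) (h 2) → Between (h 2) (f 1 * g 1) (h 3) →
  ∀ m n → Between (h (m + n)) (f m * g n) (h (suc (m + n)))
product-between {f} {g} {h} rf rg rh b₀₀ b₀₁ b₁₀ b₁₁ m n =
  recurrent-between {λ i → h (i + n)} {λ i → f i * g n} {λ i → h (suc (i + n))}
    (recurrent (λ i → step rh (i + n))) (*-recurrentʳ (g n) rf)
    (recurrent (λ i → step rh (suc (i + n))))
    (recurrent-between rh (*-recurrentˡ (f 0) rg) (shift 1 rh) b₀₀ b₀₁ n)
    (recurrent-between (shift 1 rh) (*-recurrentˡ (f 1) rg) (shift 2 rh) b₁₀ b₁₁ n)
    m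

StrictlyIncreasing : (ℕ → ℕ) → Set
StrictlyIncreasing f = ∀ n → f n < f (suc n)

module _ {f} (f↑ : StrictlyIncreasing f) where

  increasing-< : ∀ {i j} → i < j → f i < f j
  increasing-< {i} {suc j} (s≤s i≤j) with m≤n⇒m<n∨m≡n i≤j
  ... | inj₁ i<j  = <-trans (increasing-< i<j) (f↑ j)
  ... | inj₂ refl = f↑ j

  increasing-injective : ∀ {i j} → f i ≡ f j → i ≡ j
  increasing-injective {i} {j} eq with <-cmp i j
  ... | tri< i<j _ _ = ⊥-elim (<-irrefl eq (increasing-< i<j))
  ... | tri≈ _ i≡j _ = i≡j
  ... | tri> _ _ j<i = ⊥-elim (<-irrefl (sym eq) (increasing-< j<i))

  -- If `i ≤ j` then `f i ≤ f j`, and if `j < i` then `f (suc j) ≤ f i`; each contradicts one of the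
  -- two bounds.
  not-between : ∀ i j {v} → Between (f j) v (f (suc j)) → f i ≢ v
  not-between i j (fj<fi , fi<fj′) refl with <-cmp i j
  ... | tri< i<j _ _  = <-asym fj<fi (increasing-< i<j)
  ... | tri≈ _ refl _ = <-irrefl refl fj<fi
  ... | tri> _ _ j<i with m≤n⇒m<n∨m≡n j<i
  ...   | inj₁ j′<i = <-asym fi<fj′ (increasing-< j′<i)
  ...   | inj₂ refl = <-irrefl refl fi<fj′

-- The shifts skip F 1 = F 2 and L 0 > L 1, where monotonicity fails.
F₂ L₁ : ℕ → ℕ
F₂ i = F (2 + i)
L₁ i = L (1 + i)

F-recurrent : Recurrent F
F-recurrent = recurrent (λ _ → refl)

L-recurrent : Recurrent L
L-recurrent = recurrent (λ _ → refl)

F₂-increasing : StrictlyIncreasing F₂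
F₂-increasing = recurrent-< (shift 2 F-recurrent) (shift 3 F-recurrent)
  (proj₁ (between {1} {2} {3})) (proj₁ (between {2} {3} {4}))

L₁-increasing : StrictlyIncreasing L₁
L₁-increasing = recurrent-< (shift 1 L-recurrent) (shift 2 L-recurrent)
  (proj₁ (between {1} {3} {4})) (proj₁ (between {3} {4} {5}))

-- The offset reflects growth rates: with φ the golden ratio, `L a * L b` is roughly φ^(a+b) and
-- `F k` roughly φ^k/√5, where φ < √5 < φ².
L*L-between-F : ∀ m n → Between (F (7 + (m + n))) (L (3 + m) * L (3 + n)) (F (8 + (m + n)))
L*L-between-F = product-between
  (shift 3 L-recurrent) (shift 3 L-recurrent) (shift 7 F-recurrent)
  between between between between

F≡L*L-solutions L≡F*F-solutions : List (ℕ × ℕ × ℕ)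
F≡L*L-solutions = (1 , 1 , 1) ∷ (2 , 1 , 1) ∷ (4 , 1 , 2) ∷ (8 , 2 , 4) ∷ []
L≡F*F-solutions = (1 , 1 , 1) ∷ (1 , 1 , 2) ∷ (1 , 2 , 2) ∷ (2 , 1 , 4) ∷ (2 , 2 , 4) ∷ (3 , 3 , 3) ∷ []

-- The first entries are `k - 2`. The solution with `k = 1` is restored in `F≡L*L`.
F₂≡L*L : ∀ i m n → 0 < m → m ≤ n → F₂ i ≡ L m * L n →
  (i , m , n) ∈ ((0 , 1 , 1) ∷ (2 , 1 , 2) ∷ (6 , 2 , 4) ∷ [])
F₂≡L*L i 1 1 _ _ eq with increasing-injective F₂-increasing {i} {0} eq
... | refl = here refl
F₂≡L*L i 1 2 _ _ eq with increasing-injective F₂-increasing {i} {2} eq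
... | refl = there (here refl)
-- As `L 1 = 1` is smaller than φ, the bounds are one index lower here: `F (m + n)` and
-- `F (m + n + 1)` in the original `m` and `n`.
F₂≡L*L i 1 (suc (suc (suc n))) _ _ eq = ⊥-elim (not-between F₂-increasing i (2 + n)
  (recurrent-between (shift 4 F-recurrent) (*-recurrentˡ 1 (shift 3 L-recurrent))
    (shift 5 F-recurrent) between between n) eq)
F₂≡L*L i 2 1 _ (s≤s ()) eq
-- The products 9 and 12 of this and the next case lie between `F 6 = 8` and `F 7 = 13`.
F₂≡L*L i 2 2 _ _ eq = ⊥-elim (not-between F₂-increasing i 4 between eq)
F₂≡L*L i 2 3 _ _ eq = ⊥-elim (not-between F₂-increasing i 4 between eq)
F₂≡L*L i 2 4 _ _ eq with increasing-injective F₂-increasing {i} {6} eq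
... | refl = there (there (here refl))
-- The recurrence starts only at 5 because `L 2 * L 4 = 21 = F 8` attains the upper bound.
F₂≡L*L i 2 (suc (suc (suc (suc (suc n))))) _ _ eq = ⊥-elim (not-between F₂-increasing i (6 + n)
  (recurrent-between (shift 8 F-recurrent) (*-recurrentˡ 3 (shift 5 L-recurrent))
    (shift 9 F-recurrent) between between n) eq)
F₂≡L*L i (suc (suc (suc m))) 1 _ (s≤s ()) eq
F₂≡L*L i (suc (suc (suc m))) 2 _ (s≤s (s≤s ())) eq
F₂≡L*L i (suc (suc (suc m))) (suc (suc (suc n))) _ _ eq =
  ⊥-elim (not-between F₂-increasing i (5 + (m + n)) (L*L-between-F m n) eq)

F≡L*L : ∀ k m n → 0 < k → 0 < m → m ≤ n → F k ≡ L m * L n →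
  (k , m , n) ∈ F≡L*L-solutions
-- `F 1` equals `F₂ 0`, so `k = 1` has the same pairs `(m , n)` as `k = 2`.
F≡L*L 1 m n _ 0<m m≤n eq with F₂≡L*L 0 m n 0<m m≤n eq
... | here refl = here refl
... | there (here ())
... | there (there (here ()))
F≡L*L (suc (suc i)) m n _ 0<m m≤n eq with F₂≡L*L i m n 0<m m≤n eq
... | here refl                 = there (here refl)
... | there (here refl)         = there (there (here refl))
... | there (there (here refl)) = there (there (there (here refl)))

-- Here `F a * F b` is roughly φ^(a+b)/5 and φ³ < 5 < φ⁴, so the bounding indices are `a + b - 4`
-- and `a + b - 3`.
F*F-between-L : ∀ m n → Between (L (4 + (m + n))) (F (4 + m) * F (4 + n)) (L (5 + (m + n)))
F*F-between-L = product-between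
  (shift 4 F-recurrent) (shift 4 F-recurrent) (shift 4 L-recurrent)
  between between between between

-- m = 1 and m = 2 share the products F m * F n = 1 * F n.
1*F-between-L : ∀ n → Between (L (3 + n)) (1 * F (5 + n)) (L (4 + n))
1*F-between-L = recurrent-between (shift 3 L-recurrent)
  (*-recurrentˡ 1 (shift 5 F-recurrent)) (shift 4 L-recurrent) between between

L₁≡F*F : ∀ i m n → 0 < m → m ≤ n → L₁ i ≡ F m * F n →
  (suc i , m , n) ∈ L≡F*F-solutions
L₁≡F*F i 1 1 _ _ eq with increasing-injective L₁-increasing {i} {0} eq
... | refl = here refl
L₁≡F*F i 1 2 _ _ eq with increasing-injective L₁-increasing {i} {0} eq
... | refl = there (here refl)
-- The product 2 is `L 0`, which a positive `k` excludes; it lies between `L 1 = 1` and `L 2 = 3`.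
L₁≡F*F i 1 3 _ _ eq = ⊥-elim (not-between L₁-increasing i 0 between eq)
L₁≡F*F i 1 4 _ _ eq with increasing-injective L₁-increasing {i} {1} eq
... | refl = there (there (there (here refl)))
L₁≡F*F i 1 (suc (suc (suc (suc (suc n))))) _ _ eq =
  ⊥-elim (not-between L₁-increasing i (2 + n) (1*F-between-L n) eq)
L₁≡F*F i 2 1 _ (s≤s ()) eq
L₁≡F*F i 2 2 _ _ eq with increasing-injective L₁-increasing {i} {0} eq
... | refl = there (there (here refl))
L₁≡F*F i 2 3 _ _ eq = ⊥-elim (not-between L₁-increasing i 0 between eq)
L₁≡F*F i 2 4 _ _ eq with increasing-injective L₁-increasing {i} {1} eq
... | refl = there (there (there (there (here refl))))
L₁≡F*F i 2 (suc (suc (suc (suc (suc n))))) _ _ eq =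
  ⊥-elim (not-between L₁-increasing i (2 + n) (1*F-between-L n) eq)
L₁≡F*F i (suc (suc (suc m))) 1 _ (s≤s ()) eq
L₁≡F*F i (suc (suc (suc m))) 2 _ (s≤s (s≤s ())) eq
-- `F 3 * F 3 = 4 = L 3` attains the upper bound, so the row `m = 3` stays outside `F*F-between-L`.
L₁≡F*F i 3 3 _ _ eq with increasing-injective L₁-increasing {i} {2} eq
... | refl = there (there (there (there (there (here refl)))))
L₁≡F*F i 3 (suc (suc (suc (suc n)))) _ _ eq = ⊥-elim (not-between L₁-increasing i (2 + n)
  (recurrent-between (shift 3 L-recurrent) (*-recurrentˡ 2 (shift 4 F-recurrent))
    (shift 4 L-recurrent) between between n) eq)
L₁≡F*F i (suc (suc (suc (suc m)))) 3 _ (s≤s (s≤s (s≤s ()))) eq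
L₁≡F*F i (suc (suc (suc (suc m)))) (suc (suc (suc (suc n)))) _ _ eq =
  ⊥-elim (not-between L₁-increasing i (3 + (m + n)) (F*F-between-L m n) eq)

theorem2 : (k m n : ℕ) → 0 < k → 0 < m → 0 < n → m ≤ n →
    (F k ≡ L m * L n ⇔
    (k , m , n) ∈ ((1 , 1 , 1) ∷ (2 , 1 , 1) ∷ (4 , 1 , 2) ∷ (8 , 2 , 4) ∷ []))
    ×
    (L k ≡ F m * F n ⇔
    (k , m , n) ∈ ((1 , 1 , 1) ∷ (1 , 1 , 2) ∷ (1 , 2 , 2) ∷ (2 , 1 , 4) ∷ (2 , 2 , 4) ∷ (3 , 3 , 3) ∷ []))
theorem2 k@(suc i) m n 0<k 0<m _ m≤n =
  mk⇔ (F≡L*L k m n 0<k 0<m m≤n) F≡L*L⁻¹ , mk⇔ (L₁≡F*F i m n 0<m m≤n) L≡F*F⁻¹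
  where
  F≡L*L⁻¹ : (k , m , n) ∈ F≡L*L-solutions → F k ≡ L m * L n
  -- Each membership proof fixes all three indices, and both sides then compute to the same numeral.
  F≡L*L⁻¹ (here refl)                         = refl
  F≡L*L⁻¹ (there (here refl))                 = refl
  F≡L*L⁻¹ (there (there (here refl)))         = refl
  F≡L*L⁻¹ (there (there (there (here refl)))) = refl

  L≡F*F⁻¹ : (k , m , n) ∈ L≡F*F-solutions → L k ≡ F m * F n
  L≡F*F⁻¹ (here refl)                                         = refl
  L≡F*F⁻¹ (there (here refl))                                 = refl
  L≡F*F⁻¹ (there (there (here refl)))                         = refl
  L≡F*F⁻¹ (there (there (there (here refl))))                 = refl
  L≡F*F⁻¹ (there (there (there (there (here refl)))))         = refl
  L≡F*F⁻¹ (there (there (there (there (there (here refl)))))) = refl
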